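{- Let $k\geq 4$ and $d\geq 2$ be integers, and let $G$ be any finite simple graph with maximum degree $d$. Then $$s_k(G)\leq \left\lceil 6\sqrt{10}\, d^{\frac{k-1}{k-2}}\right\rceil .$$
   Context: $P_k$ denotes the path on $k$ vertices. A $P_k$-coloring of a graph $G$ is a proper vertex coloring of $G$ in which no copy of $P_k$ in $G$ (as a subgraph, not necessarily induced) is bicolored, i.e. has its vertices colored using only two colors. The $P_k$-chromatic number $s_k(G)$ is the minimum number of colors in a $P_k$-coloring of $G$. -}

module Defs where

open import Data.Fin.Base using (Fin; zero; suc; toℕ; finToFun; funToFin)
open import Data.Fin.Properties using (any?; all?; finToFun-funToFin)
  renaming (_≟_ to _≟ᶠ_)
open import Data.List.Base using (length; filter; map; allFin)
open import Data.List.Extrema.Nat using (max)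
open import Data.Nat.Base
open import Data.Nat.Properties
open import Data.Product.Base using (∃; ∃₂; _×_; _,_)
open import Data.Sum.Base using (_⊎_; inj₁; inj₂; swap)
open import Function.Base using (id; _∘_)
open import Function.Definitions using (Injective)
open import Level using (0ℓ)
open import Relation.Binary.Core using (Rel)
open import Relation.Binary.Definitions using (Irreflexive; Symmetric)
  renaming (Decidable to Decidable₂)
open import Relation.Binary.PropositionalEquality
  using (_≡_; _≢_; _≗_; refl; sym; trans; cong; subst; subst₂)
open import Relation.Nullary.Decidable
  using (Dec; yes; no; map′; ¬?; _×-dec_; _⊎-dec_; _→-dec_)
open import Relation.Nullary.Negation using (¬_; contradiction)
open import Relation.Unary using (Pred; Decidable)

record Least (P : Pred ℕ 0ℓ) : Set where
  constructor mkLeast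
  field
    value   : ℕ
    holds   : P value
    minimal : ∀ {m} → P m → value ≤ m

least : ∀ {P : Pred ℕ 0ℓ} → Decidable P → ∀ m → P m → Least P
least     P? zero    p = mkLeast 0 p λ _ → z≤n
least {P} P? (suc m) p with P? 0
... | yes p₀ = mkLeast 0 p₀ λ _ → z≤n
... | no ¬p₀ with least (P? ∘ suc) m p
...   | mkLeast v pv min = mkLeast (suc v) pv λ {m} → min⁺ m
  where
  min⁺ : ∀ m → P m → suc v ≤ m
  min⁺ zero    q = contradiction q ¬p₀
  min⁺ (suc _) q = s≤s (min q)

record Graph (n : ℕ) : Set₁ where
  field
    Adj         : Rel (Fin n) 0ℓ
    adj?        : Decidable₂ Adj
    symmetric   : Symmetric Adj
    irreflexive : Irreflexive _≡_ Adj

open Graph public using (Adj; adj?)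

degree : ∀ {n} → Graph n → Fin n → ℕ
degree {n} G v = length (filter (adj? G v) (allFin n))

Δ : ∀ {n} → Graph n → ℕ
Δ {n} G = max 0 (map (degree G) (allFin n))

P : ∀ k → Graph k
P k = record
  { Adj         = λ i j → toℕ j ≡ suc (toℕ i) ⊎ toℕ i ≡ suc (toℕ j)
  ; adj?        = λ i j → (toℕ j ≟ suc (toℕ i)) ⊎-dec (toℕ i ≟ suc (toℕ j))
  ; symmetric   = swap
  ; irreflexive = λ where
      refl (inj₁ e) → 1+n≢n (sym e)
      refl (inj₂ e) → 1+n≢n (sym e)
  }

-- Adjacency is not reflected: the copy need not be induced.
IsCopy : ∀ {m n} → Graph m → Graph n → (Fin m → Fin n) → Set
IsCopy H G p = Injective _≡_ _≡_ p × (∀ i j → Adj H i j → Adj G (p i) (p j))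

Proper : ∀ {n c} → Graph n → (Fin n → Fin c) → Set
Proper G f = ∀ u v → Adj G u v → f u ≢ f v

Bicoloured : ∀ {m n c} → (Fin n → Fin c) → (Fin m → Fin n) → Set
Bicoloured f p = ∃₂ λ a b → ∀ i → f (p i) ≡ a ⊎ f (p i) ≡ b

IsPathColouring : ∀ {n c} → ℕ → Graph n → (Fin n → Fin c) → Set
IsPathColouring k G f =
  Proper G f × ¬ (∃ λ p → IsCopy (P k) G p × Bicoloured f p)

PathColourable : ∀ {n} → ℕ → Graph n → ℕ → Set
PathColourable {n} k G c = ∃ λ (f : Fin n → Fin c) → IsPathColouring k G f

anyFun? : ∀ {m n} {Q : Pred (Fin m → Fin n) 0ℓ} →
          (∀ {f g} → f ≗ g → Q f → Q g) → Decidable Q → Dec (∃ Q)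
anyFun? resp Q? = map′
  (λ (i , q) → finToFun i , q)
  (λ (f , q) → funToFin f , resp (sym ∘ finToFun-funToFin f) q)
  (any? (Q? ∘ finToFun))

isCopy? : ∀ {m n} (H : Graph m) (G : Graph n) → Decidable (IsCopy H G)
isCopy? H G p =
  map′ (λ inj {i} {j} → inj i j) (λ inj i j → inj {i} {j})
    (all? λ i → all? λ j → (p i ≟ᶠ p j) →-dec (i ≟ᶠ j))
  ×-dec
  all? λ i → all? λ j → adj? H i j →-dec adj? G (p i) (p j)

bicoloured? : ∀ {m n c} (f : Fin n → Fin c) → Decidable (Bicoloured {m} f)
bicoloured? f p =
  any? λ a → any? λ b → all? λ i → (f (p i) ≟ᶠ a) ⊎-dec (f (p i) ≟ᶠ b)

isCopy-resp : ∀ {m n} (H : Graph m) (G : Graph n) {p q} →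
              p ≗ q → IsCopy H G p → IsCopy H G q
isCopy-resp H G p≗q (inj , hom) =
  (λ {i} {j} e → inj (trans (p≗q i) (trans e (sym (p≗q j))))) ,
  (λ i j a → subst₂ (Adj G) (p≗q i) (p≗q j) (hom i j a))

bicoloured-resp : ∀ {m n c} (f g : Fin n → Fin c) (p q : Fin m → Fin n) →
                  f ∘ p ≗ g ∘ q → Bicoloured f p → Bicoloured g q
bicoloured-resp f g p q e (a , b , h) = a , b , λ i →
  subst (λ x → x ≡ a ⊎ x ≡ b) (e i) (h i)

isPathColouring? : ∀ {n c} k (G : Graph n) →
                   Decidable (IsPathColouring {c = c} k G)
isPathColouring? k G f =
  (all? λ u → all? λ v → adj? G u v →-dec ¬? (f u ≟ᶠ f v))
  ×-dec
  ¬? (anyFun?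
        (λ {p} {q} p≗q (c , b) →
          isCopy-resp (P k) G p≗q c ,
          bicoloured-resp f f p q (cong f ∘ p≗q) b)
        (λ p → isCopy? (P k) G p ×-dec bicoloured? f p))

pathColourable? : ∀ {n} k (G : Graph n) → Decidable (PathColourable k G)
pathColourable? k G c = anyFun? resp-≗ (isPathColouring? k G)
  where
  resp-≗ : ∀ {f g} → f ≗ g → IsPathColouring k G f → IsPathColouring k G g
  resp-≗ {f} {g} f≗g (proper , none) =
    (λ u v a e → proper u v a (trans (f≗g u) (trans e (sym (f≗g v))))) ,
    (λ (p , c , b) → none (p , c , bicoloured-resp g f p p (sym ∘ f≗g ∘ p) b))

rainbow : ∀ {n k} → 3 ≤ k → (G : Graph n) → PathColourable k G n
rainbow (s≤s (s≤s (s≤s _))) G =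
  id , (λ u v a e → Graph.irreflexive G e a) , λ (p , (inj , _) , a , b , h) →
    distinct (0≢1 ∘ inj) (0≢2 ∘ inj) (1≢2 ∘ inj)
      (h zero) (h (suc zero)) (h (suc (suc zero)))
  where
  0≢1 : ∀ {m} → Fin.zero {suc m} ≢ suc zero
  0≢1 ()
  0≢2 : ∀ {m} → Fin.zero {suc (suc m)} ≢ suc (suc zero)
  0≢2 ()
  1≢2 : ∀ {m} → Fin.suc {suc (suc m)} zero ≢ suc (suc zero)
  1≢2 ()
  distinct : ∀ {A : Set} {x y z a b : A} → x ≢ y → x ≢ z → y ≢ z →
             x ≡ a ⊎ x ≡ b → y ≡ a ⊎ y ≡ b → ¬ (z ≡ a ⊎ z ≡ b)
  distinct x≢y x≢z y≢z (inj₁ refl) (inj₁ refl) _           = x≢y refl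
  distinct x≢y x≢z y≢z (inj₁ refl) (inj₂ refl) (inj₁ refl) = x≢z refl
  distinct x≢y x≢z y≢z (inj₁ refl) (inj₂ refl) (inj₂ refl) = y≢z refl
  distinct x≢y x≢z y≢z (inj₂ refl) (inj₁ refl) (inj₁ refl) = y≢z refl
  distinct x≢y x≢z y≢z (inj₂ refl) (inj₁ refl) (inj₂ refl) = x≢z refl
  distinct x≢y x≢z y≢z (inj₂ refl) (inj₂ refl) _           = x≢y refl

leastColours : ∀ {n k} → 3 ≤ k → (G : Graph n) → Least (PathColourable k G)
leastColours {n} {k} 3≤k G = least (pathColourable? k G) n (rainbow 3≤k G)

-- The P k-chromatic number.  For k ≤ 2 a graph with an edge has no
-- P k-colouring, so the minimum need not exist.
s : ∀ {n} k → 3 ≤ k → Graph n → ℕ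
s k 3≤k G = Least.value (leastColours 3≤k G)

-- The nonnegative real ⁿ√a, with index n ≥ 1 and radicand a.
record Radical : Set where
  constructor root
  field
    index       : ℕ
    radicand    : ℕ
    .{{index≢0}} : NonZero index

infix  8 √_ _^[_/_]
infixl 7 _·_
infix  4 _≤ʳ_

⟦_⟧ : ℕ → Radical
⟦ a ⟧ = root 1 a

√_ : ℕ → Radical
√ a = root 2 a

_^[_/_] : ℕ → ℕ → (q : ℕ) → .{{NonZero q}} → Radical
a ^[ p / q ] = root q (a ^ p)

-- ᵐ√a · ⁿ√b = ᵐⁿ√(aⁿ bᵐ)
_·_ : Radical → Radical → Radical
root m a · root n b = root (m * n) (a ^ n * b ^ m) {{m*n≢0 m n}}

-- ᵐ√a ≤ ⁿ√b, compared after raising both sides to the power mn.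
_≤ʳ_ : Rel Radical 0ℓ
root m a ≤ʳ root n b = a ^ n ≤ b ^ m

_≤ʳ?_ : Decidable₂ _≤ʳ_
root m a ≤ʳ? root n b = a ^ n ≤? b ^ m

root≤radicand : ∀ x → x ≤ʳ ⟦ Radical.radicand x ⟧
root≤radicand (root (suc n) zero)    = z≤n
root≤radicand (root (suc n) (suc a)) = ^-monoʳ-≤ (suc a) (s≤s (z≤n {n}))

leastAbove : ∀ x → Least (λ c → x ≤ʳ ⟦ c ⟧)
leastAbove x = least (λ c → x ≤ʳ? ⟦ c ⟧) (Radical.radicand x) (root≤radicand x)

⌈_⌉ : Radical → ℕ
⌈ x ⌉ = Least.value (leastAbove x)

∸2-nonZero : ∀ {k} → 3 ≤ k → NonZero (k ∸ 2)
∸2-nonZero 3≤k = >-nonZero (m<n⇒0<n∸m 3≤k)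

{-# OPTIONS --safe #-}

-- Rosenfeld's counting method.  Count the total maps f : V → [c] that are good
-- colourings of G restricted to S; with M = k − 2, β ≈ c / 3 and D = d^(k−1),
-- induction on S gives β · #good (S − v) ≤ c · #good S.  A map that is good on
-- S − v but not on S repeats at v the colour of a neighbour (a fraction at most
-- d / c), or makes a path through v bicoloured.  On such a path take two
-- adjacent vertices other than v: the remaining M vertices, v among them, have
-- at most two possible colours each once these two are coloured, so the fraction
-- is at most (2 / c)^M relative to #good (S − v − the other M − 1), which by
-- induction is at most (c / β)^(M−1) · #good (S − v).  There are at most M · D
-- choices of the path, and M · 2^M ≤ 4^M, so 4^M · D ≤ β^M closes the induction.
module Submission where

open import Defs

open import Data.Fin.Base using (Fin; zero; suc; toℕ)
open import Data.Fin.Properties using (any?)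
  renaming (_≟_ to _≟ᶠ_; all? to allᶠ?; suc-injective to suc-injectiveᶠ)
open import Data.Fin.Subset using (Subset; Nonempty; ∣_∣; _-_; _⊆_; ⊤)
  renaming (_∈_ to _∈ˢ_; _∉_ to _∉ˢ_)
open import Data.Fin.Subset.Properties
  using (∈⊤; nonempty?; x∈p∧x≢y⇒x∈p-y; x∈p⇒∣p-x∣<∣p∣; p─q⊆p; p⊆q⇒∣p∣≤∣q∣)
  renaming (_∈?_ to _∈ˢ?_)
open import Data.List.Base
  using (List; []; _∷_; [_]; length; allFin; concatMap; drop; filter; map; take;
         upTo; tabulate; reverse; _++_; _ʳ++_)
open import Data.List.Extrema.Nat using (xs≤max)
open import Data.List.Membership.Propositional using (_∈_; _∉_; lose)
open import Data.List.Membership.Propositional.Properties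
  using (∈-∃++; ∈-map⁺; ∈-allFin; ∈-filter⁺; ∈-filter⁻; ∈-concatMap⁺; ∈-upTo⁺; ∈-upTo⁻;
         ∈-tabulate⁺)
open import Data.List.Properties
  using (length-map; length-++; length-filter; length-upTo; length-ʳ++; length-tabulate;
         ʳ++-defn; reverse-involutive)
open import Data.List.Relation.Binary.Permutation.Propositional
  using (_↭_; ↭-sym; ↭-trans; ↭⇒↭ₛ)
open import Data.List.Relation.Binary.Permutation.Propositional.Properties
  using (shift; shifts; ++↭ʳ++; ++-comm; All-resp-↭)
open import Data.List.Relation.Binary.Permutation.Setoid.Properties using (Unique-resp-↭)
open import Data.List.Relation.Unary.All as All using (All; []; _∷_)
open import Data.List.Relation.Unary.All.Properties using (all-filter)
  renaming (tabulate⁺ to All-tabulate⁺)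
open import Data.List.Relation.Unary.AllPairs using ([]; _∷_)
open import Data.List.Relation.Unary.Any as Any using (Any; here; there; toSum)
open import Data.List.Relation.Unary.Linked using (Linked; []; [-]; _∷_)
open import Data.List.Relation.Unary.Unique.Propositional using (Unique)
open import Data.List.Relation.Unary.Unique.Propositional.Properties using ()
  renaming (tabulate⁺ to Unique-tabulate⁺)
open import Data.Nat.Base
open import Data.Nat.DivMod
open import Data.Nat.Properties
open import Data.Nat.Tactic.RingSolver using (solve-∀)
open import Data.Product.Base as Product using (∃; ∃₂; _×_; _,_; proj₁; proj₂)
open import Data.Sum.Base as Sum using (_⊎_; inj₁; inj₂)
open import Data.Vec.Base using (Vec; []; _∷_; here; there; lookup; _[_]≔_)
open import Data.Vec.Properties using (lookup∘update; lookup∘update′)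
open import Function.Base using (_∘_; id)
open import Level using (0ℓ)
open import Relation.Binary.PropositionalEquality hiding ([_])
open import Relation.Nullary.Decidable
  using (Dec; yes; no; ¬?; _×-dec_; _→-dec_; _⊎-dec_)
open import Relation.Nullary.Negation using (¬_; contradiction)
open import Relation.Unary using (Pred; Decidable)

open import Algebra.Properties.CommutativeMonoid.Sum +-0-commutativeMonoid
  using (∑-distrib-+; ∑-comm)
open import Algebra.Properties.CommutativeSemigroup *-commutativeSemigroup
  using (interchange; x∙yz≈y∙xz)
open import Algebra.Properties.Semiring.Sum +-*-semiring
  using (sum; sum-cong-≗; *-distribˡ-sum; *-distribʳ-sum)

open ≤-Reasoning

-- Indicators and finite sums.

𝟙 : {A : Set} → Dec A → ℕ
𝟙 (yes _) = 1
𝟙 (no _)  = 0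

𝟙-yes : {A : Set} (a? : Dec A) → A → 𝟙 a? ≡ 1
𝟙-yes (yes _) _ = refl
𝟙-yes (no ¬a) a = contradiction a ¬a

𝟙-no : {A : Set} (a? : Dec A) → ¬ A → 𝟙 a? ≡ 0
𝟙-no (yes a) ¬a = contradiction a ¬a
𝟙-no (no _)  _  = refl

𝟙-pos : {A : Set} (a? : Dec A) → 0 < 𝟙 a? → A
𝟙-pos (yes a) _ = a

𝟙-mono : {A B : Set} (a? : Dec A) (b? : Dec B) → (A → B) → 𝟙 a? ≤ 𝟙 b?
𝟙-mono (no _)  _  _ = z≤n
𝟙-mono (yes a) b? f = ≤-reflexive (sym (𝟙-yes b? (f a)))

𝟙-⊎ : {A B C : Set} (a? : Dec A) (b? : Dec B) (c? : Dec C) →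
      (A → B ⊎ C) → 𝟙 a? ≤ 𝟙 b? + 𝟙 c?
𝟙-⊎ (no _)  _  _  _ = z≤n
𝟙-⊎ (yes a) b? c? f with f a
... | inj₁ b = ≤-trans (≤-reflexive (sym (𝟙-yes b? b))) (m≤m+n _ _)
... | inj₂ c = ≤-trans (≤-reflexive (sym (𝟙-yes c? c))) (m≤n+m _ _)

𝟙-× : {A B C : Set} (a? : Dec A) (b? : Dec B) (c? : Dec C) →
      (A → B × C) → 𝟙 a? ≤ 𝟙 b? * 𝟙 c?
𝟙-× (no _)  _  _  _ = z≤n
𝟙-× (yes a) b? c? f =
  ≤-reflexive (sym (cong₂ _*_ (𝟙-yes b? (proj₁ (f a))) (𝟙-yes c? (proj₂ (f a)))))

sum-mono : ∀ {m} {g h : Fin m → ℕ} → (∀ i → g i ≤ h i) → sum g ≤ sum h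
sum-mono {zero}  _   = z≤n
sum-mono {suc m} g≤h = +-mono-≤ (g≤h zero) (sum-mono (g≤h ∘ suc))

sum-const : ∀ m x → sum {m} (λ _ → x) ≡ m * x
sum-const zero    x = refl
sum-const (suc m) x = cong (x +_) (sum-const m x)

sum-pos : ∀ {m} (g : Fin m → ℕ) → 0 < sum g → ∃ λ i → 0 < g i
sum-pos {suc m} g 0<s with g zero in eq
... | suc _ = zero , subst (0 <_) (sym eq) z<s
... | zero  = Product.map suc id (sum-pos (g ∘ suc) 0<s)

sum-𝟙-≟ : ∀ {m} (b : Fin m) → sum (λ a → 𝟙 (a ≟ᶠ b)) ≡ 1
sum-𝟙-≟ {suc m} zero    = cong suc (trans
  (sum-cong-≗ {m} λ i → 𝟙-no (suc i ≟ᶠ zero) λ ())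
  (trans (sum-const m 0) (*-zeroʳ m)))
sum-𝟙-≟ {suc m} (suc b) = cong₂ _+_
  (𝟙-no (zero ≟ᶠ suc b) λ ())
  (trans (sum-cong-≗ {m} λ i → ≤-antisym
           (𝟙-mono (suc i ≟ᶠ suc b) (i ≟ᶠ b) suc-injectiveᶠ)
           (𝟙-mono (i ≟ᶠ b) (suc i ≟ᶠ suc b) (cong suc)))
         (sum-𝟙-≟ b))

-- Each `y` contributes the single colour `g y`; coincidences among these only lower the count.
sum-𝟙-any : ∀ {m} {A : Set} (g : A → Fin m) ys →
            sum (λ a → 𝟙 (Any.any? (λ y → a ≟ᶠ g y) ys)) ≤ length ys
sum-𝟙-any {m} g []       = ≤-reflexive (trans (sum-const m 0) (*-zeroʳ m))
sum-𝟙-any {m} g (y ∷ ys) = begin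
  sum (λ a → 𝟙 (Any.any? (λ y → a ≟ᶠ g y) (y ∷ ys)))
    ≤⟨ sum-mono (λ a → 𝟙-⊎ (Any.any? (λ y → a ≟ᶠ g y) (y ∷ ys)) (a ≟ᶠ g y)
                            (Any.any? (λ y → a ≟ᶠ g y) ys) toSum) ⟩
  sum (λ a → 𝟙 (a ≟ᶠ g y) + 𝟙 (Any.any? (λ y → a ≟ᶠ g y) ys))
    ≡⟨ ∑-distrib-+ {m} (λ a → 𝟙 (a ≟ᶠ g y)) _ ⟩
  sum (λ a → 𝟙 (a ≟ᶠ g y)) + sum (λ a → 𝟙 (Any.any? (λ y → a ≟ᶠ g y) ys))
    ≤⟨ +-mono-≤ (≤-reflexive (sum-𝟙-≟ (g y))) (sum-𝟙-any g ys) ⟩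
  1 + length ys ∎

-- Counting colourings.

module _ {c : ℕ} where

  -- Colourings are vectors here, so that the sum over all of them unfolds one vertex at a time.
  ∑ᵛ : ∀ {n} → (Vec (Fin c) n → ℕ) → ℕ
  ∑ᵛ {zero}  w = w []
  ∑ᵛ {suc n} w = sum λ a → ∑ᵛ (w ∘ (a ∷_))

  ∑ᵛ-mono : ∀ {n} {w w′ : Vec (Fin c) n → ℕ} → (∀ f → w f ≤ w′ f) → ∑ᵛ w ≤ ∑ᵛ w′
  ∑ᵛ-mono {zero}  w≤w′ = w≤w′ []
  ∑ᵛ-mono {suc n} w≤w′ = sum-mono λ a → ∑ᵛ-mono (w≤w′ ∘ (a ∷_))

  ∑ᵛ-+ : ∀ {n} (w w′ : Vec (Fin c) n → ℕ) → ∑ᵛ (λ f → w f + w′ f) ≡ ∑ᵛ w + ∑ᵛ w′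
  ∑ᵛ-+ {zero}  w w′ = refl
  ∑ᵛ-+ {suc n} w w′ = trans
    (sum-cong-≗ λ a → ∑ᵛ-+ (w ∘ (a ∷_)) (w′ ∘ (a ∷_)))
    (∑-distrib-+ {c} (λ a → ∑ᵛ (w ∘ (a ∷_))) _)

  ∑ᵛ-* : ∀ {n} x (w : Vec (Fin c) n → ℕ) → ∑ᵛ (λ f → x * w f) ≡ x * ∑ᵛ w
  ∑ᵛ-* {zero}  x w = refl
  ∑ᵛ-* {suc n} x w = trans
    (sum-cong-≗ λ a → ∑ᵛ-* x (w ∘ (a ∷_)))
    (sym (*-distribˡ-sum {c} x λ a → ∑ᵛ (w ∘ (a ∷_))))

  ∑ᵛ-sum : ∀ {m n} (w : Vec (Fin c) n → Fin m → ℕ) →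
           ∑ᵛ (λ f → sum (w f)) ≡ sum λ i → ∑ᵛ λ f → w f i
  ∑ᵛ-sum {n = zero}  w = refl
  ∑ᵛ-sum {m} {suc n} w = trans
    (sum-cong-≗ λ a → ∑ᵛ-sum λ f → w (a ∷ f))
    (∑-comm {c} {m} λ a i → ∑ᵛ λ f → w (a ∷ f) i)

  ∑ᵛ-pos : ∀ {n} (w : Vec (Fin c) n → ℕ) → 0 < ∑ᵛ w → ∃ λ f → 0 < w f
  ∑ᵛ-pos {zero}  w 0<w = [] , 0<w
  ∑ᵛ-pos {suc n} w 0<∑ with sum-pos _ 0<∑
  ... | a , 0<∑a = Product.map (a ∷_) id (∑ᵛ-pos (w ∘ (a ∷_)) 0<∑a)

  ∑ᵛ-replicate : ∀ n → ∑ᵛ {n} (λ _ → 1) ≡ c ^ n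
  ∑ᵛ-replicate zero    = refl
  ∑ᵛ-replicate (suc n) = trans (sum-cong-≗ {c} λ _ → ∑ᵛ-replicate n) (sum-const c (c ^ n))

  -- Every colouring arises as `f [ x ]≔ a` from exactly `c` pairs `(f , a)`: `a` is forced, and the
  -- old colour at `x` is free.
  ∑ᵛ-resample : ∀ {n} (x : Fin n) (w : Vec (Fin c) n → ℕ) →
                ∑ᵛ (λ f → sum λ a → w (f [ x ]≔ a)) ≡ c * ∑ᵛ w
  ∑ᵛ-resample zero    w = trans
    (sum-const c _)
    (cong (c *_) (∑ᵛ-sum λ f a → w (a ∷ f)))
  ∑ᵛ-resample (suc x) w = trans
    (sum-cong-≗ λ a → ∑ᵛ-resample x (w ∘ (a ∷_)))
    (sym (*-distribˡ-sum {c} c λ a → ∑ᵛ (w ∘ (a ∷_))))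

  Colouring : ℕ → Set
  Colouring = Vec (Fin c)

  # : ∀ {n} {P : Pred (Colouring n) 0ℓ} → Decidable P → ℕ
  # P? = ∑ᵛ (𝟙 ∘ P?)

  #-mono : ∀ {n} {P Q : Pred (Colouring n) 0ℓ} (P? : Decidable P) (Q? : Decidable Q) →
           (∀ f → P f → Q f) → # P? ≤ # Q?
  #-mono P? Q? P⇒Q = ∑ᵛ-mono λ f → 𝟙-mono (P? f) (Q? f) (P⇒Q f)

  #-⊎ : ∀ {n} {P Q R : Pred (Colouring n) 0ℓ}
        (P? : Decidable P) (Q? : Decidable Q) (R? : Decidable R) →
        (∀ f → P f → Q f ⊎ R f) → # P? ≤ # Q? + # R?
  #-⊎ P? Q? R? P⇒Q⊎R = ≤-trans
    (∑ᵛ-mono λ f → 𝟙-⊎ (P? f) (Q? f) (R? f) (P⇒Q⊎R f))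
    (≤-reflexive (∑ᵛ-+ (𝟙 ∘ Q?) (𝟙 ∘ R?)))

  -- Union bound, multiplied through by `a` to keep fractions out.
  #-any : ∀ {n} {A : Set} {Q : A → Pred (Colouring n) 0ℓ} (Q? : ∀ x → Decidable (Q x))
          a {b} xs → All (λ x → a * # (Q? x) ≤ b) xs →
          a * # (λ f → Any.any? (λ x → Q? x f) xs) ≤ length xs * b
  #-any {n} Q? a [] [] = ≤-reflexive (trans (cong (a *_) (∑ᵛ-* {n} 0 (λ _ → 0))) (*-zeroʳ a))
  #-any Q? a {b} (x ∷ xs) (q ∷ qs) = begin
    a * # (λ f → Any.any? (λ x → Q? x f) (x ∷ xs))
      ≤⟨ *-monoʳ-≤ a (#-⊎ _ (Q? x) (λ f → Any.any? (λ x → Q? x f) xs) λ _ → toSum) ⟩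
    a * (# (Q? x) + # (λ f → Any.any? (λ x → Q? x f) xs))
      ≡⟨ *-distribˡ-+ a _ _ ⟩
    a * # (Q? x) + a * # (λ f → Any.any? (λ x → Q? x f) xs)
      ≤⟨ +-mono-≤ q (#-any Q? a xs qs) ⟩
    b + length xs * b ∎

  #-pos : ∀ {n} {P : Pred (Colouring n) 0ℓ} (P? : Decidable P) → 0 < # P? → ∃ P
  #-pos P? 0<# with ∑ᵛ-pos _ 0<#
  ... | f , 0<𝟙 = f , 𝟙-pos (P? f) 0<𝟙

  #-full : ∀ {n} {P : Pred (Colouring n) 0ℓ} (P? : Decidable P) →
           (∀ f → P f) → c ^ n ≤ # P?
  #-full {n} P? p = ≤-trans (≤-reflexive (sym (∑ᵛ-replicate n)))
    (∑ᵛ-mono λ f → ≤-reflexive (sym (𝟙-yes (P? f) (p f))))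

  -- Colour repetitions at vertices whose colour is free.

  module _ {n : ℕ} where

    Repeats : List (Fin n) → Colouring n → Fin n → Set
    Repeats ys f x = Any (λ y → lookup f x ≡ lookup f y) ys

    repeats? : ∀ ys f → Decidable (Repeats ys f)
    repeats? ys f x = Any.any? (λ y → lookup f x ≟ᶠ lookup f y) ys

    -- One direction suffices: recolouring x is reversible.
    Ignores : Pred (Colouring n) 0ℓ → Fin n → Set
    Ignores P x = ∀ f a → P (f [ x ]≔ a) → P f

    repeats-update : ∀ {x z} ys f a → x ≢ z → z ∉ ys →
                     Repeats ys (f [ z ]≔ a) x → Repeats ys f x
    repeats-update (y ∷ ys) f a x≢z z∉ (here e)  =
      here (trans (sym (lookup∘update′ x≢z f a))
        (trans e (lookup∘update′ (λ y≡z → z∉ (here (sym y≡z))) f a)))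
    repeats-update (y ∷ ys) f a x≢z z∉ (there r) =
      there (repeats-update ys f a x≢z (z∉ ∘ there) r)

    repeats-updated : ∀ {x} ys f a → x ∉ ys →
                      Repeats ys (f [ x ]≔ a) x → Any (λ y → a ≡ lookup f y) ys
    repeats-updated {x} (y ∷ ys) f a x∉ (here e)  =
      here (trans (sym (lookup∘update x f a))
        (trans e (lookup∘update′ (λ y≡x → x∉ (here (sym y≡x))) f a)))
    repeats-updated (y ∷ ys) f a x∉ (there r) =
      there (repeats-updated ys f a (x∉ ∘ there) r)

    -- Resample the colour of `x`. Membership in `P` survives, the colours on `ys` stay fixed, and
    -- so at most `length ys` of the `c` new colours produce a repetition.
    #-repeats : ∀ {P : Pred (Colouring n) 0ℓ} (P? : Decidable P) x ys → x ∉ ys → Ignores P x →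
                c * # (λ f → repeats? ys f x ×-dec P? f) ≤ length ys * # P?
    #-repeats P? x ys x∉ys ign = begin
      c * # (λ f → repeats? ys f x ×-dec P? f)
        ≡⟨ ∑ᵛ-resample x _ ⟨
      ∑ᵛ (λ f → sum λ a → 𝟙 (repeats? ys (f [ x ]≔ a) x ×-dec P? (f [ x ]≔ a)))
        ≤⟨ ∑ᵛ-mono (λ f → sum-mono λ a →
             𝟙-× _ (Any.any? (λ y → a ≟ᶠ lookup f y) ys) (P? f)
               (Product.map (repeats-updated ys f a x∉ys) (ign f a))) ⟩
      ∑ᵛ (λ f → sum λ a → 𝟙 (Any.any? (λ y → a ≟ᶠ lookup f y) ys) * 𝟙 (P? f))
        ≤⟨ ∑ᵛ-mono (λ f → ≤-trans
             (≤-reflexive (sym (*-distribʳ-sum {c} (𝟙 (P? f)) _)))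
             (*-monoˡ-≤ (𝟙 (P? f)) (sum-𝟙-any (lookup f) ys))) ⟩
      ∑ᵛ (λ f → length ys * 𝟙 (P? f))
        ≡⟨ ∑ᵛ-* (length ys) (𝟙 ∘ P?) ⟩
      length ys * # P? ∎

    -- The vertices of `xs` are resampled one after another, each contributing a factor
    -- `length ys / c`; the powers of `c` are cleared from the denominators.
    #-all-repeat : ∀ {P : Pred (Colouring n) 0ℓ} (P? : Decidable P) xs ys →
                   Unique xs → All (_∉ ys) xs → All (Ignores P) xs →
                   c ^ length xs * # (λ f → All.all? (repeats? ys f) xs ×-dec P? f) ≤
                   length ys ^ length xs * # P?
    #-all-repeat P? [] ys _ _ _ = *-monoʳ-≤ 1 (#-mono _ P? λ _ → proj₂)
    #-all-repeat {P} P? (x ∷ xs) ys (x∉xs ∷ uniq) (x∉ys ∷ xs∉ys) (ign ∷ igns) = begin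
      c * c ^ length xs * # (λ f → All.all? (repeats? ys f) (x ∷ xs) ×-dec P? f)
        ≤⟨ *-monoʳ-≤ (c * c ^ length xs) (#-mono _ (λ f → repeats? ys f x ×-dec Q? f)
             λ { f (r ∷ rs , p) → r , rs , p }) ⟩
      c * c ^ length xs * # (λ f → repeats? ys f x ×-dec Q? f)
        ≡⟨ cong (_* # (λ f → repeats? ys f x ×-dec Q? f)) (*-comm c _) ⟩
      c ^ length xs * c * # (λ f → repeats? ys f x ×-dec Q? f)
        ≡⟨ *-assoc (c ^ length xs) c _ ⟩
      c ^ length xs * (c * # (λ f → repeats? ys f x ×-dec Q? f))
        ≤⟨ *-monoʳ-≤ (c ^ length xs) (#-repeats Q? x ys x∉ys ignQ) ⟩
      c ^ length xs * (length ys * # Q?)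
        ≡⟨ x∙yz≈y∙xz (c ^ length xs) (length ys) (# Q?) ⟩
      length ys * (c ^ length xs * # Q?)
        ≤⟨ *-monoʳ-≤ (length ys) (#-all-repeat P? xs ys uniq xs∉ys igns) ⟩
      length ys * (length ys ^ length xs * # P?)
        ≡⟨ *-assoc (length ys) _ _ ⟨
      length ys * length ys ^ length xs * # P? ∎
      where
      Q : Pred (Colouring n) 0ℓ
      Q f = All (Repeats ys f) xs × P f
      Q? : Decidable Q
      Q? f = All.all? (repeats? ys f) xs ×-dec P? f
      -- The condition left for the remaining vertices does not see the colour of `x`, as `x` is
      -- neither among them nor in `ys`.
      ignQ : Ignores Q x
      ignQ f a (rs , p) =
        All.zipWith (λ (x≢z , r) → repeats-update ys f a (x≢z ∘ sym) x∉ys r) (x∉xs , rs) ,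
        ign f a p

-- Lists, and splitting a path into two arms.

length-concatMap-≤ : ∀ {A B : Set} (g : A → List B) {b : ℕ} xs →
                     (∀ {x} → x ∈ xs → length (g x) ≤ b) →
                     length (concatMap g xs) ≤ length xs * b
length-concatMap-≤ g []       _  = z≤n
length-concatMap-≤ g (x ∷ xs) g≤ = ≤-trans
  (≤-reflexive (length-++ (g x)))
  (+-mono-≤ (g≤ (here refl)) (length-concatMap-≤ g xs (g≤ ∘ there)))

linked-tabulate : ∀ {A : Set} {R : A → A → Set} {m} (g : Fin m → A) →
                  (∀ i j → toℕ j ≡ suc (toℕ i) → R (g i) (g j)) → Linked R (tabulate g)
linked-tabulate {m = zero}        g r = []
linked-tabulate {m = suc zero}    g r = [-]
linked-tabulate {m = suc (suc m)} g r =
  r zero (suc zero) refl ∷ linked-tabulate (g ∘ suc) λ i j e → r (suc i) (suc j) (cong suc e)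

-- In `l ʳ++ v ∷ r` the list `l` is read backwards, so both arms of the path run outwards from `v`;
-- symmetry of `R` turns the edges of the left arm around.
linked-ʳ++⁻ : {A : Set} {R : A → A → Set} → (∀ {x y} → R x y → R y x) →
              ∀ l {v r} → Linked R (l ʳ++ v ∷ r) → Linked R (v ∷ l) × Linked R (v ∷ r)
linked-ʳ++⁻ sym-R []      lk = [-] , lk
linked-ʳ++⁻ sym-R (x ∷ l) lk with linked-ʳ++⁻ sym-R l lk
... | lk-l , Rxv ∷ lk-r = sym-R Rxv ∷ lk-l , lk-r

∈-∃ʳ++ : {A : Set} {v : A} {q : List A} → v ∈ q → ∃₂ λ l r → q ≡ l ʳ++ v ∷ r
∈-∃ʳ++ {v = v} v∈q with ∈-∃++ v∈q
... | ys , r , refl = reverse ys , r , sym (trans (ʳ++-defn (reverse ys))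
        (cong (_++ v ∷ r) (reverse-involutive ys)))

-- Removing a list of vertices from a subset.

x∈p-y⇒x∈p : ∀ {n} {S : Subset n} {x} y → x ∈ˢ S - y → x ∈ˢ S
x∈p-y⇒x∈p {S = S} y = p─q⊆p S _

x∈p-y⇒x≢y : ∀ {n} {S : Subset n} {x y} → x ∈ˢ S - y → x ≢ y
x∈p-y⇒x≢y {S = S} {x} x∈ refl = x∉p-x S x x∈
  where
  x∉p-x : ∀ {n} (S : Subset n) x → ¬ x ∈ˢ S - x
  x∉p-x (_ ∷ S) (suc x) (there x∈) = x∉p-x S x x∈

infixl 6 _∖_
_∖_ : ∀ {n} → Subset n → List (Fin n) → Subset n
S ∖ []       = S
S ∖ (x ∷ xs) = (S ∖ xs) - x

∖-⊆ : ∀ {n} (S : Subset n) xs → S ∖ xs ⊆ S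
∖-⊆ S []       = id
∖-⊆ S (x ∷ xs) = ∖-⊆ S xs ∘ x∈p-y⇒x∈p x

x∈p∖xs⇒x∉xs : ∀ {n} (S : Subset n) {x} xs → x ∈ˢ S ∖ xs → x ∉ xs
x∈p∖xs⇒x∉xs S (y ∷ xs) x∈ (here x≡y) = x∈p-y⇒x≢y x∈ x≡y
x∈p∖xs⇒x∉xs S (y ∷ xs) x∈ (there x∈xs) = x∈p∖xs⇒x∉xs S xs (x∈p-y⇒x∈p y x∈) x∈xs

-- Walks, and the patterns of paths through a vertex.

module _ {n : ℕ} (G : Graph n) where

  open import Data.List.Membership.DecPropositional (_≟ᶠ_ {n}) using (_∉?_)
  open import Data.List.Relation.Unary.Unique.DecPropositional (_≟ᶠ_ {n}) using (unique?)

  private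
    V : Set
    V = Fin n
    d : ℕ
    d = Δ G

  neighbours : V → List V
  neighbours v = filter (adj? G v) (allFin n)

  degree≤Δ : ∀ v → degree G v ≤ d
  degree≤Δ v =
    All.lookup (xs≤max 0 (map (degree G) (allFin n))) (∈-map⁺ (degree G) (∈-allFin v))

  ∈-neighbours : ∀ {u v} → Adj G v u → u ∈ neighbours v
  ∈-neighbours {u} {v} = ∈-filter⁺ (adj? G v) (∈-allFin u)

  -- Each list holds the `j` vertices after the start `v`, which is left out. Repeated vertices are
  -- allowed, since only an upper bound on the number of paths is wanted.
  walks : ℕ → V → List (List V)
  walks zero    v = [ [] ]
  walks (suc j) v = concatMap (λ u → map (u ∷_) (walks j u)) (neighbours v)

  length-walks : ∀ j v → length (walks j v) ≤ d ^ j
  length-walks zero    v = s≤s z≤n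
  length-walks (suc j) v = ≤-trans
    (length-concatMap-≤ (λ u → map (u ∷_) (walks j u)) (neighbours v) λ {u} _ →
      ≤-trans (≤-reflexive (length-map (u ∷_) (walks j u))) (length-walks j u))
    (*-monoˡ-≤ (d ^ j) (degree≤Δ v))

  ∈-walks : ∀ {v} r → Linked (Adj G) (v ∷ r) → r ∈ walks (length r) v
  ∈-walks []      _          = here refl
  ∈-walks {v} (u ∷ r) (a ∷ lk) =
    ∈-concatMap⁺ (λ u → map (u ∷_) (walks (length r) u)) {xs = neighbours v}
      (Any.map (λ { refl → ∈-map⁺ (u ∷_) (∈-walks r lk) }) (∈-neighbours a))

  module _ (m : ℕ) where

    private
      k : ℕ
      k = 3 + m

    -- (xs , ys) abstracts a bicoloured path with 3 + m vertices through v: ys are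
    -- the two vertices next to v on an arm of length ≥ 2, and xs are the others except v.
    IsPattern : V → Pred (List V × List V) 0ℓ
    IsPattern v (xs , ys) =
      Unique (v ∷ xs) × All (_∉ ys) (v ∷ xs) × length xs ≡ m × length ys ≤ 2

    isPattern? : ∀ v → Decidable (IsPattern v)
    isPattern? v (xs , ys) =
      unique? (v ∷ xs) ×-dec All.all? (λ x → x ∉? ys) (v ∷ xs)
        ×-dec (length xs ≟ m) ×-dec (length ys ≤? 2)

    -- The two vertices of `r` nearest to `v` become the reference pair; the rest of both arms must
    -- repeat their colours.
    armsPattern : List V → List V → List V × List V
    armsPattern l r = l ++ drop 2 r , take 2 r

    armsOfLength : V → ℕ → List (List V × List V)
    armsOfLength v j = concatMap (λ l → map (armsPattern l) (walks (2 + m ∸ j) v)) (walks j v)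

    -- The first arm has `j ≤ m` of the `2 + m` vertices other than `v`, so the second has at least
    -- the two that the reference pair requires.
    arms : V → List (List V × List V)
    arms v = concatMap (armsOfLength v) (upTo (suc m))

    patterns : V → List (List V × List V)
    patterns v = filter (isPattern? v) (arms v)

    length-armsOfLength : ∀ v {j} → j ≤ m → length (armsOfLength v j) ≤ d ^ (2 + m)
    length-armsOfLength v {j} j≤m = begin
      length (armsOfLength v j)
        ≤⟨ length-concatMap-≤ (λ l → map (armsPattern l) (walks (2 + m ∸ j) v)) (walks j v)
             (λ {l} _ → ≤-trans
               (≤-reflexive (length-map (armsPattern l) (walks (2 + m ∸ j) v)))
               (length-walks (2 + m ∸ j) v)) ⟩
      length (walks j v) * d ^ (2 + m ∸ j) ≤⟨ *-monoˡ-≤ _ (length-walks j v) ⟩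
      d ^ j * d ^ (2 + m ∸ j)              ≡⟨ ^-distribˡ-+-* d j _ ⟨
      d ^ (j + (2 + m ∸ j))                ≡⟨ cong (d ^_) (m+[n∸m]≡n (m≤n⇒m≤o+n 2 j≤m)) ⟩
      d ^ (2 + m)                          ∎

    length-patterns : ∀ v → length (patterns v) ≤ suc m * d ^ (2 + m)
    length-patterns v = begin
      length (patterns v)
        ≤⟨ length-filter (isPattern? v) (arms v) ⟩
      length (arms v)
        ≤⟨ length-concatMap-≤ (armsOfLength v) (upTo (suc m))
             (λ j∈ → length-armsOfLength v (s≤s⁻¹ (∈-upTo⁻ j∈))) ⟩
      length (upTo (suc m)) * d ^ (2 + m)
        ≡⟨ cong (_* d ^ (2 + m)) (length-upTo (suc m)) ⟩
      suc m * d ^ (2 + m) ∎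

    ∈-patterns : ∀ {v} l {y z} r → Linked (Adj G) (v ∷ l) → Linked (Adj G) (v ∷ y ∷ z ∷ r) →
                 length l + length r ≡ m → Unique (l ++ v ∷ y ∷ z ∷ r) →
                 (l ++ r , y ∷ z ∷ []) ∈ patterns v
    ∈-patterns {v} l {y} {z} r lk-l lk-r len uniq =
      ∈-filter⁺ (isPattern? v) ∈-arms (isPattern (Unique-resp-↭ (setoid V) (↭⇒↭ₛ ↭y∷z∷v) uniq))
      where
      -- With the reference pair in front, distinctness along the path splits into the distinctness
      -- and disjointness demanded of a pattern.
      ↭y∷z∷v : l ++ v ∷ y ∷ z ∷ r ↭ y ∷ z ∷ v ∷ l ++ r
      ↭y∷z∷v = ↭-trans (shifts l (v ∷ y ∷ z ∷ []))
        (↭-sym (shift v (y ∷ z ∷ []) (l ++ r)))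

      isPattern : Unique (y ∷ z ∷ v ∷ l ++ r) → IsPattern v (l ++ r , y ∷ z ∷ [])
      isPattern ((_ ∷ y∉) ∷ z∉ ∷ u) =
        u ,
        All.zipWith (λ where
          (y≢x , _) (here x≡y) → y≢x (sym x≡y)
          (_ , z≢x) (there (here x≡z)) → z≢x (sym x≡z)) (y∉ , z∉) ,
        trans (length-++ l) len , ≤-refl

      -- The reference pair uses up two of the `2 + m` vertices, leaving at most `m` for `l`.
      j<1+m : length l < suc m
      j<1+m = s≤s (m+n≤o⇒m≤o (length l) (≤-reflexive len))

      length-r : length (y ∷ z ∷ r) ≡ 2 + m ∸ length l
      length-r = sym (trans (cong (λ o → 2 + o ∸ length l) (sym len))
        (trans (cong (λ o → 2 + o ∸ length l) (+-comm (length l) _))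
          (m+n∸n≡m (2 + length r) (length l))))

      ∈-arms : (l ++ r , y ∷ z ∷ []) ∈ arms v
      ∈-arms = ∈-concatMap⁺ (armsOfLength v) {xs = upTo (suc m)} (lose (∈-upTo⁺ j<1+m)
        (∈-concatMap⁺ (λ l′ → map (armsPattern l′) (walks (2 + m ∸ length l) v))
          {xs = walks (length l) v} (lose (∈-walks l lk-l)
            (∈-map⁺ (armsPattern l)
              (subst (λ j → y ∷ z ∷ r ∈ walks j v) length-r (∈-walks _ lk-r))))))

-- Good colourings and their extension by one vertex.

module _ {n : ℕ} (G : Graph n) (m : ℕ) where

  private
    V : Set
    V = Fin n
    d : ℕ
    d = Δ G
    k : ℕ
    k = 3 + m

  -- Two different colours from `a`, `b` exhaust both, so every vertex of a bicoloured path repeats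
  -- one of them.
  palette : ∀ {C : Set} {a b x y z : C} → y ≢ z → y ≡ a ⊎ y ≡ b → z ≡ a ⊎ z ≡ b →
            x ≡ a ⊎ x ≡ b → x ≡ y ⊎ x ≡ z
  palette y≢z (inj₁ refl) (inj₁ refl) _           = contradiction refl y≢z
  palette y≢z (inj₁ refl) (inj₂ refl) x∈ab        = x∈ab
  palette y≢z (inj₂ refl) (inj₁ refl) x∈ab        = Sum.swap x∈ab
  palette y≢z (inj₂ refl) (inj₂ refl) _           = contradiction refl y≢z

  module _ {c : ℕ} where

    ProperOn : Subset n → Pred (Colouring {c} n) 0ℓ
    ProperOn S f = ∀ u v → u ∈ˢ S → v ∈ˢ S → Adj G u v → lookup f u ≢ lookup f v

    BicolouredPathIn : Subset n → Colouring {c} n → Pred (Fin k → V) 0ℓ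
    BicolouredPathIn S f p = (IsCopy (P k) G p × Bicoloured (lookup f) p) × (∀ i → p i ∈ˢ S)

    Good : Subset n → Pred (Colouring {c} n) 0ℓ
    Good S f = ProperOn S f × ¬ ∃ (BicolouredPathIn S f)

    bicolouredPathIn? : ∀ S f → Dec (∃ (BicolouredPathIn S f))
    bicolouredPathIn? S f = anyFun?
      (λ {p} {q} p≗q ((copy , bi) , p∈S) →
        (isCopy-resp (P k) G p≗q copy ,
         bicoloured-resp (lookup f) (lookup f) p q (cong (lookup f) ∘ p≗q) bi) ,
        λ i → subst (_∈ˢ S) (p≗q i) (p∈S i))
      (λ p → (isCopy? (P k) G p ×-dec bicoloured? (lookup f) p) ×-dec allᶠ? λ i → p i ∈ˢ? S)

    good? : ∀ S → Decidable (Good S)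
    good? S f =
      (allᶠ? λ u → allᶠ? λ v → (u ∈ˢ? S) →-dec ((v ∈ˢ? S) →-dec
        (adj? G u v →-dec ¬? (lookup f u ≟ᶠ lookup f v))))
      ×-dec ¬? (bicolouredPathIn? S f)

    good-resp : ∀ {S T} f g → T ⊆ S → (∀ {x} → x ∈ˢ T → lookup g x ≡ lookup f x) →
                Good S f → Good T g
    good-resp f g T⊆S g≗f (proper , none) =
      (λ u v u∈ v∈ a e → proper u v (T⊆S u∈) (T⊆S v∈) a
        (trans (sym (g≗f u∈)) (trans e (g≗f v∈)))) ,
      λ (p , (copy , bi) , p∈T) → none (p ,
        (copy , bicoloured-resp (lookup g) (lookup f) p p (λ i → g≗f (p∈T i)) bi) , T⊆S ∘ p∈T)

    good-⊆ : ∀ {S T} → T ⊆ S → ∀ f → Good S f → Good T f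
    good-⊆ T⊆S f = good-resp f f T⊆S λ _ → refl

    -- Goodness on `S` reads only the colours inside `S`. This is what permits resampling at removed
    -- vertices.
    good-ignores : ∀ {S x} → x ∉ˢ S → Ignores (Good S) x
    good-ignores {S} {x} x∉S f a = good-resp {S} (f [ x ]≔ a) f id λ {y} y∈S →
      sym (lookup∘update′ (λ { refl → x∉S y∈S }) f a)

    Follows : Colouring {c} n → V → List V × List V → Set
    Follows f v (xs , ys) = All (Repeats ys f) (v ∷ xs)

    follows? : ∀ f v → Decidable (Follows f v)
    follows? f v (xs , ys) = All.all? (repeats? ys f) (v ∷ xs)

    module _ {S : Subset n} f (proper : ProperOn S f) where

      any-follows-arms : ∀ v l r → Linked (Adj G) (v ∷ l) → Linked (Adj G) (v ∷ r) →
                    length l + length r ≡ 2 + m → 2 ≤ length r → Unique (l ++ v ∷ r) →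
                    ∀ {a b} →
                    All (λ x → x ∈ˢ S × (lookup f x ≡ a ⊎ lookup f x ≡ b)) (l ++ v ∷ r) →
                    Any (Follows f v) (patterns G m v)
      any-follows-arms v l (y ∷ z ∷ r) lk-l lk-r@(_ ∷ y~z ∷ _) len (s≤s (s≤s _)) uniq ab
        with All-resp-↭ (shifts l (v ∷ y ∷ z ∷ [])) ab
      ... | (_ , fv) ∷ (y∈S , fy) ∷ (z∈S , fz) ∷ abs =
        lose (∈-patterns G m l r lk-l lk-r len′ uniq) (rep fv ∷ All.map (rep ∘ proj₂) abs)
        where
        len′ : length l + length r ≡ m
        len′ = suc-injective (suc-injective (trans (sym
          (trans (+-suc (length l) _) (cong suc (+-suc (length l) _)))) len))
        rep : ∀ {x} → _ → Repeats (y ∷ z ∷ []) f x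
        rep fx with palette (proper y z y∈S z∈S y~z) fy fz fx
        ... | inj₁ x~y = here x~y
        ... | inj₂ x~z = there (here x~z)
      any-follows-arms v l (y ∷ []) _ _ _ (s≤s ())

      -- The arms at `v` have `2 + m ≥ 3` vertices together, so one of them has at least two and
      -- supplies the adjacent reference pair; the arms are exchanged if it is the left one.
      any-follows : 1 ≤ m → ∀ {v p} j → p j ≡ v → BicolouredPathIn S f p →
                    Any (Follows f v) (patterns G m v)
      any-follows 1≤m {v} {p} j refl (((inj , hom) , a , b , bi) , p∈S)
        with ∈-∃ʳ++ (∈-tabulate⁺ {f = p} j)
      ... | l , r , q≡ = by-longer-arm (2 ≤? length r)
        where
        arms-linked : Linked (Adj G) (v ∷ l) × Linked (Adj G) (v ∷ r)
        arms-linked = linked-ʳ++⁻ (Graph.symmetric G) l (subst (Linked (Adj G)) q≡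
          (linked-tabulate p λ i j e → hom i j (inj₁ e)))

        tab↭ : tabulate p ↭ l ++ v ∷ r
        tab↭ = subst (_↭ l ++ v ∷ r) (sym q≡) (↭-sym (++↭ʳ++ l (v ∷ r)))

        flip↭ : l ++ v ∷ r ↭ r ++ v ∷ l
        flip↭ = ↭-trans (++-comm l (v ∷ r)) (↭-sym (shift v r l))

        uniq : Unique (l ++ v ∷ r)
        uniq = Unique-resp-↭ (setoid V) (↭⇒↭ₛ tab↭) (Unique-tabulate⁺ inj)

        ab : All (λ x → x ∈ˢ S × (lookup f x ≡ a ⊎ lookup f x ≡ b)) (l ++ v ∷ r)
        ab = All-resp-↭ tab↭ (All-tabulate⁺ λ i → p∈S i , bi i)

        len : length l + length r ≡ 2 + m
        len = suc-injective (trans (sym (+-suc (length l) (length r)))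
          (trans (sym (length-ʳ++ l)) (trans (cong length (sym q≡)) (length-tabulate p))))

        by-longer-arm : Dec (2 ≤ length r) → Any (Follows f v) (patterns G m v)
        by-longer-arm (yes 2≤r) =
          any-follows-arms v l r (proj₁ arms-linked) (proj₂ arms-linked) len 2≤r uniq ab
        by-longer-arm (no 2≰r)  =
          any-follows-arms v r l (proj₂ arms-linked) (proj₁ arms-linked)
            (trans (+-comm (length r) _) len) 2≤l
            (Unique-resp-↭ (setoid V) (↭⇒↭ₛ flip↭) uniq) (All-resp-↭ flip↭ ab)
          where
          2≤l : 2 ≤ length l
          2≤l = +-cancelʳ-≤ 1 2 (length l) (begin
            3                   ≤⟨ +-monoʳ-≤ 2 1≤m ⟩
            2 + m               ≡⟨ len ⟨
            length l + length r ≤⟨ +-monoʳ-≤ (length l) (s≤s⁻¹ (≰⇒> 2≰r)) ⟩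
            length l + 1        ∎)

    #good : Subset n → ℕ
    #good S = # (good? S)

    module Extension (S : Subset n) (v : V) where
      S′ : Subset n
      S′ = S - v

      -- Neighbours outside `S` are included as well; this only enlarges the count of bad
      -- colourings.
      Near : Pred (Colouring {c} n) 0ℓ
      Near f = Repeats (neighbours G v) f v × Good S′ f

      near? : Decidable Near
      near? f = repeats? (neighbours G v) f v ×-dec good? S′ f

      Blocked : List V × List V → Pred (Colouring {c} n) 0ℓ
      Blocked t f = Follows f v t × Good S′ f

      blocked? : ∀ t → Decidable (Blocked t)
      blocked? t f = follows? f v t ×-dec good? S′ f

      anyBlocked? : Decidable (λ f → Any (λ t → Blocked t f) (patterns G m v))
      anyBlocked? f = Any.any? (λ t → blocked? t f) (patterns G m v)

      nearOrBlocked? : Decidable (λ f → Near f ⊎ Any (λ t → Blocked t f) (patterns G m v))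
      nearOrBlocked? f = near? f ⊎-dec anyBlocked? f

      v∉neighbours : v ∉ neighbours G v
      v∉neighbours v∈ =
        Graph.irreflexive G refl (proj₂ (∈-filter⁻ (adj? G v) {xs = allFin n} v∈))

      -- Any new defect involves `v`: a monochromatic edge at `v`, or a bicoloured path through `v`.
      good-or-bad : 1 ≤ m → ∀ f → Good S′ f →
                    Good S f ⊎ (Near f ⊎ Any (λ t → Blocked t f) (patterns G m v))
      good-or-bad 1≤m f good′@(proper′ , none′)
        with repeats? (neighbours G v) f v | bicolouredPathIn? S f
      ... | yes near | _ = inj₂ (inj₁ (near , good′))
      ... | no ¬near | b? = by b?
        where
        proper : ProperOn S f
        proper u w u∈ w∈ a e with u ≟ᶠ v | w ≟ᶠ v
        ... | yes refl | _        = ¬near (lose (∈-neighbours G a) e)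
        ... | no _     | yes refl = ¬near (lose (∈-neighbours G (Graph.symmetric G a)) (sym e))
        ... | no u≢v   | no w≢v   =
          proper′ u w (x∈p∧x≢y⇒x∈p-y u∈ u≢v) (x∈p∧x≢y⇒x∈p-y w∈ w≢v) a e

        by : Dec (∃ (BicolouredPathIn S f)) →
             Good S f ⊎ (Near f ⊎ Any (λ t → Blocked t f) (patterns G m v))
        by (no none) = inj₁ (proper , none)
        by (yes (p , bad@(copy-bi , p∈S))) with any? (λ i → p i ≟ᶠ v)
        ... | yes (j , pj≡v) =
          inj₂ (inj₂ (Any.map (_, good′) (any-follows f proper 1≤m j pj≡v bad)))
        -- A path that avoids `v` lies in `S - v`, where no bicoloured path exists.
        ... | no avoids      = contradiction
          (p , copy-bi , λ i → x∈p∧x≢y⇒x∈p-y (p∈S i) λ e → avoids (i , e)) none′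

      #-near : c * # near? ≤ d * #good S′
      #-near = ≤-trans
        (#-repeats (good? S′) v (neighbours G v) v∉neighbours
          (good-ignores {S′} {v} λ v∈ → x∈p-y⇒x≢y v∈ refl))
        (*-monoˡ-≤ (#good S′) (degree≤Δ G v))

      -- Weaken goodness on `S′` to goodness on `T`, which ignores `v` and all of `xs`; then these
      -- `suc j` vertices can be resampled. The hypothesis `removal` converts the count for `T` back
      -- to `S′` at the price `(c / β) ^ j`.
      #-blocked : ∀ β .{{_ : NonZero c}} xs ys → Unique (v ∷ xs) → All (_∉ ys) (v ∷ xs) →
                  length ys ≤ 2 → β ^ length xs * #good (S′ ∖ xs) ≤ c ^ length xs * #good S′ →
                  (c * β ^ length xs) * # (blocked? (xs , ys)) ≤ 2 ^ suc (length xs) * #good S′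
      #-blocked β xs ys uniq apart ys≤2 removal = *-cancelˡ-≤ (c ^ j) {{m^n≢0 c j}} (begin
        c ^ j * ((c * β ^ j) * B)          ≡⟨ lemma₁ (c ^ j) c (β ^ j) B ⟩
        β ^ j * (c ^ suc j * B)            ≤⟨ *-monoʳ-≤ (β ^ j) (begin
            c ^ suc j * B
              ≤⟨ *-monoʳ-≤ (c ^ suc j) (#-mono _ (λ f → follows? f v (xs , ys) ×-dec good? T f)
                   λ { f (fol , good) → fol , good-⊆ (∖-⊆ S′ xs) f good }) ⟩
            c ^ suc j * # (λ f → follows? f v (xs , ys) ×-dec good? T f)
              ≤⟨ #-all-repeat (good? T) (v ∷ xs) ys uniq apart ign ⟩
            length ys ^ suc j * #good T
              ≤⟨ *-monoˡ-≤ (#good T) (^-monoˡ-≤ (suc j) ys≤2) ⟩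
            2 ^ suc j * #good T ∎) ⟩
        β ^ j * (2 ^ suc j * #good T)          ≡⟨ x∙yz≈y∙xz (β ^ j) (2 ^ suc j) (#good T) ⟩
        2 ^ suc j * (β ^ j * #good T)          ≤⟨ *-monoʳ-≤ (2 ^ suc j) removal ⟩
        2 ^ suc j * (c ^ j * #good S′)         ≡⟨ x∙yz≈y∙xz (2 ^ suc j) (c ^ j) (#good S′) ⟩
        c ^ j * (2 ^ suc j * #good S′)         ∎)
        where
        j : ℕ
        j = length xs
        T : Subset n
        T = S′ ∖ xs
        B : ℕ
        B = # (blocked? (xs , ys))
        ign : All (Ignores (Good T)) (v ∷ xs)
        ign = good-ignores {T} (λ v∈ → x∈p-y⇒x≢y (∖-⊆ S′ xs v∈) refl) ∷
              All.tabulate λ x∈xs → good-ignores {T} λ x∈ → x∈p∖xs⇒x∉xs S′ xs x∈ x∈xs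
        lemma₁ : ∀ q c b x → q * ((c * b) * x) ≡ b * ((c * q) * x)
        lemma₁ = solve-∀

      -- Of the `c ≥ 2 * β + d` shares of `#good S′`, at most `d` are lost to neighbours and at most
      -- `β` to bicoloured paths, so `β` remain.
      extend : 1 ≤ m → ∀ β .{{_ : NonZero c}} .{{_ : NonZero β}} →
               2 * β + d ≤ c → 2 ^ suc m * (suc m * d ^ (2 + m)) ≤ β ^ suc m →
               (∀ xs → β ^ length xs * #good (S′ ∖ xs) ≤ c ^ length xs * #good S′) →
               β * #good S′ ≤ c * #good S
      extend 1≤m β 2β+d≤c few removal = +-cancelʳ-≤ ((d + β) * #good S′) _ _ (begin
        β * #good S′ + (d + β) * #good S′
          ≡⟨ lemma₂ β d (#good S′) ⟩
        (2 * β + d) * #good S′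
          ≤⟨ *-monoˡ-≤ (#good S′) 2β+d≤c ⟩
        c * #good S′
          ≤⟨ *-monoʳ-≤ c (≤-trans
               (#-⊎ (good? S′) (good? S) nearOrBlocked? (good-or-bad 1≤m))
               (+-monoʳ-≤ (#good S) (#-⊎ nearOrBlocked? near? anyBlocked? λ _ → id))) ⟩
        c * (#good S + (# near? + # anyBlocked?))
          ≡⟨ lemma₃ c (#good S) _ _ ⟩
        c * #good S + (c * # near? + c * # anyBlocked?)
          ≤⟨ +-monoʳ-≤ (c * #good S) (+-mono-≤ #-near #-anyBlocked) ⟩
        c * #good S + (d * #good S′ + β * #good S′)
          ≡⟨ cong (c * #good S +_) (*-distribʳ-+ (#good S′) d β) ⟨
        c * #good S + (d + β) * #good S′ ∎)
        where
        lemma₂ : ∀ b d e → b * e + (d + b) * e ≡ (2 * b + d) * e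
        lemma₂ = solve-∀
        lemma₃ : ∀ c e x y → c * (e + (x + y)) ≡ c * e + (c * x + c * y)
        lemma₃ = solve-∀
        lemma₄ : ∀ c b x → b * (c * x) ≡ (c * b) * x
        lemma₄ = solve-∀
        lemma₅ : ∀ p q e → q * (p * e) ≡ (p * q) * e
        lemma₅ = solve-∀
        lemma₆ : ∀ b q e → (b * q) * e ≡ q * (b * e)
        lemma₆ = solve-∀
        #-anyBlocked : c * # anyBlocked? ≤ β * #good S′
        #-anyBlocked = *-cancelˡ-≤ (β ^ m) {{m^n≢0 β m}} (begin
          -- The factor `β ^ m` gives the coefficient `c * β ^ m` under which each single pattern is
          -- bounded.
          β ^ m * (c * # anyBlocked?)    ≡⟨ lemma₄ c (β ^ m) _ ⟩
          (c * β ^ m) * # anyBlocked?    ≤⟨ #-any blocked? (c * β ^ m) (patterns G m v)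
              (All.map (λ { {xs , ys} (uniq , apart , len , ys≤2) →
                  subst (λ j → (c * β ^ j) * # (blocked? (xs , ys)) ≤ 2 ^ suc j * #good S′) len
                    (#-blocked β xs ys uniq apart ys≤2 (removal xs)) })
                (all-filter (isPattern? G m v) (arms G m v))) ⟩
          length (patterns G m v) * (2 ^ suc m * #good S′)
            ≤⟨ *-monoˡ-≤ _ (length-patterns G m v) ⟩
          (suc m * d ^ (2 + m)) * (2 ^ suc m * #good S′)
            ≡⟨ lemma₅ (2 ^ suc m) (suc m * d ^ (2 + m)) (#good S′) ⟩
          (2 ^ suc m * (suc m * d ^ (2 + m))) * #good S′ ≤⟨ *-monoˡ-≤ (#good S′) few ⟩
          β ^ suc m * #good S′               ≡⟨ lemma₆ β (β ^ m) (#good S′) ⟩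
          β ^ m * (β * #good S′)             ∎)

-- Induction on the size of the coloured set.

module _ {n : ℕ} (G : Graph n) (m : ℕ) {c : ℕ} (β : ℕ) .{{_ : NonZero c}} .{{_ : NonZero β}}
         (1≤m : 1 ≤ m) (2β+Δ≤c : 2 * β + Δ G ≤ c)
         (few : 2 ^ suc m * (suc m * Δ G ^ (2 + m)) ≤ β ^ suc m) where

  private
    #colourings : Subset n → ℕ
    #colourings = #good G m {c}

  β≤c : β ≤ c
  β≤c = ≤-trans (≤-trans (m≤m+n β _) (m≤m+n (2 * β) _)) 2β+Δ≤c

  -- Mutual induction with `removal` on the bound `b` for the size of `S`: a single removal at
  -- `suc b` uses repeated removals from `S - v` at `b`, and these use single removals at `b`.
  removal-step : ∀ b S v → ∣ S ∣ ≤ b → β * #colourings (S - v) ≤ c * #colourings S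

  removal : ∀ b S → ∣ S ∣ ≤ b → ∀ xs →
            β ^ length xs * #colourings (S ∖ xs) ≤ c ^ length xs * #colourings S
  removal b S ∣S∣≤b []       = ≤-refl
  removal b S ∣S∣≤b (x ∷ xs) = begin
    β * β ^ j * #colourings (S ∖ (x ∷ xs))   ≡⟨ lemma β (β ^ j) _ ⟩
    β ^ j * (β * #colourings (S ∖ (x ∷ xs))) ≤⟨ *-monoʳ-≤ (β ^ j) (removal-step b (S ∖ xs) x
                                        (≤-trans (p⊆q⇒∣p∣≤∣q∣ (∖-⊆ S xs)) ∣S∣≤b)) ⟩
    β ^ j * (c * #colourings (S ∖ xs))       ≡⟨ x∙yz≈y∙xz (β ^ j) c (#colourings (S ∖ xs)) ⟩
    c * (β ^ j * #colourings (S ∖ xs))       ≤⟨ *-monoʳ-≤ c (removal b S ∣S∣≤b xs) ⟩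
    c * (c ^ j * #colourings S)              ≡⟨ *-assoc c (c ^ j) (#colourings S) ⟨
    c * c ^ j * #colourings S                ∎
    where
    j : ℕ
    j = length xs
    lemma : ∀ b q x → b * q * x ≡ q * (b * x)
    lemma = solve-∀

  removal-step b S v ∣S∣≤b = by (v ∈ˢ? S) b ∣S∣≤b
    where
    by : Dec (v ∈ˢ S) → ∀ b → ∣ S ∣ ≤ b → β * #colourings (S - v) ≤ c * #colourings S
    -- If `v` is not in `S`, then `S ⊆ S - v` and only `β ≤ c` is left to use.
    by (no v∉S)  b       _     = *-mono-≤ β≤c (#-mono (good? G m (S - v)) (good? G m S)
      (good-⊆ G m λ x∈S → x∈p∧x≢y⇒x∈p-y x∈S λ { refl → v∉S x∈S }))
    by (yes v∈S) zero    ∣S∣≤0 = contradiction (≤-trans (x∈p⇒∣p-x∣<∣p∣ v∈S) ∣S∣≤0) λ ()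
    by (yes v∈S) (suc b) ∣S∣≤b = Extension.extend G m S v 1≤m β 2β+Δ≤c few
      (removal b (S - v) (s≤s⁻¹ (≤-trans (x∈p⇒∣p-x∣<∣p∣ v∈S) ∣S∣≤b)))

  -- All `c ^ n` colourings are good on the empty set, and each added vertex keeps at least a
  -- positive fraction `β / c` of the count.
  #colourings-pos : ∀ b S → ∣ S ∣ ≤ b → 0 < #colourings S
  #colourings-pos b S = by (nonempty? S) b
    where
    by : Dec (Nonempty S) → ∀ b → ∣ S ∣ ≤ b → 0 < #colourings S
    by (no empty)        _       _     = ≤-trans (m^n>0 c n) (#-full (good? G m S) λ f →
      (λ u v u∈S → contradiction (u , u∈S) empty) ,
      λ (p , _ , p∈S) → empty (p zero , p∈S zero))
    by (yes (v , v∈S)) zero    ∣S∣≤0 = contradiction (≤-trans (x∈p⇒∣p-x∣<∣p∣ v∈S) ∣S∣≤0) λ ()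
    by (yes (v , v∈S)) (suc b) ∣S∣≤b = *-cancelˡ-< c 0 (#colourings S) (begin-strict
      c * 0         ≡⟨ *-zeroʳ c ⟩
      0             <⟨ *-mono-< (>-nonZero⁻¹ β)
                         (#colourings-pos b (S - v) (s≤s⁻¹ (≤-trans
                           (x∈p⇒∣p-x∣<∣p∣ v∈S) ∣S∣≤b))) ⟩
      β * #colourings (S - v) ≤⟨ removal-step (suc b) S v ∣S∣≤b ⟩
      c * #colourings S       ∎)

  pathColourable : PathColourable (3 + m) G c
  pathColourable = colouring (#-pos (good? G m ⊤) (#colourings-pos ∣ ⊤ {n} ∣ ⊤ ≤-refl))
    where
    colouring : ∃ (Good G m ⊤) → PathColourable (3 + m) G c
    colouring (f , proper , none) = lookup f , (λ u v → proper u v ∈⊤ ∈⊤) ,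
      λ (p , copy , bi) → none (p , (copy , bi) , λ _ → ∈⊤)

-- Arithmetic of the constants.

^-cancelʳ-≤ : ∀ j .{{_ : NonZero j}} {x y} → x ^ j ≤ y ^ j → x ≤ y
^-cancelʳ-≤ j {x} {y} x^j≤y^j with x ≤? y
... | yes x≤y = x≤y
... | no x≰y  = contradiction x^j≤y^j (<⇒≱ (^-monoˡ-< j (≰⇒> x≰y)))

^-distribʳ-* : ∀ x y j → (x * y) ^ j ≡ x ^ j * y ^ j
^-distribʳ-* x y zero    = refl
^-distribʳ-* x y (suc j) =
  trans (cong (x * y *_) (^-distribʳ-* x y j)) (interchange x y (x ^ j) (y ^ j))

n≤2^n : ∀ n → n ≤ 2 ^ n
n≤2^n zero    = z≤n
n≤2^n (suc n) = +-mono-≤ (m^n>0 2 n) (≤-trans (n≤2^n n) (m≤m+n (2 ^ n) 0))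

-- Here `M = k - 2`, and `large` is the real inequality between `6√10` times `d` to the power
-- `(M + 1) / M` and `c`, raised to the power `2 * M`.
module Numerics (M c d : ℕ) .{{_ : NonZero M}} (2≤d : 2 ≤ d)
                (large : 360 ^ M * (d ^ suc M) ^ 2 ≤ c ^ (2 * M)) where

  private
    D : ℕ
    D = d ^ suc M
    instance
      d≢0 : NonZero d
      d≢0 = >-nonZero (≤-trans (s≤s z≤n) 2≤d)

  -- 16² ≤ 360 = (6√10)² turns the hypothesis on c into 16^M D ≤ c^M, and c ≤ 4β.
  β : ℕ
  β = c / 3

  16^M*D≤c^M : 16 ^ M * D ≤ c ^ M
  16^M*D≤c^M = ^-cancelʳ-≤ 2 (begin
    (16 ^ M * D) ^ 2     ≡⟨ ^-distribʳ-* (16 ^ M) D 2 ⟩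
    (16 ^ M) ^ 2 * D ^ 2 ≤⟨ *-monoˡ-≤ (D ^ 2) (begin
        (16 ^ M) ^ 2     ≡⟨ ^-*-assoc 16 M 2 ⟩
        16 ^ (M * 2)     ≡⟨ cong (16 ^_) (*-comm M 2) ⟩
        16 ^ (2 * M)     ≡⟨ ^-*-assoc 16 2 M ⟨
        256 ^ M          ≤⟨ ^-monoˡ-≤ M (m≤m+n 256 104) ⟩
        360 ^ M          ∎) ⟩
    360 ^ M * D ^ 2      ≤⟨ large ⟩
    c ^ (2 * M)          ≡⟨ cong (c ^_) (*-comm 2 M) ⟩
    c ^ (M * 2)          ≡⟨ ^-*-assoc c M 2 ⟨
    (c ^ M) ^ 2          ∎)

  16≤c : 16 ≤ c
  16≤c = ^-cancelʳ-≤ M (≤-trans (m≤m*n (16 ^ M) D {{m^n≢0 d (suc M)}}) 16^M*D≤c^M)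

  2≤β : 2 ≤ β
  2≤β = ≤-trans (m≤m+n 2 3) (/-monoˡ-≤ 3 16≤c)

  c≤4β : c ≤ 4 * β
  c≤4β = begin
    c             ≡⟨ m≡m%n+[m/n]*n c 3 ⟩
    -- The remainder is at most 2, hence at most one further `β`.
    c % 3 + β * 3 ≤⟨ +-mono-≤ (≤-trans (s≤s⁻¹ (m%n<n c 3)) 2≤β) (≤-reflexive (*-comm β 3)) ⟩
    4 * β         ∎

  4^M*D≤β^M : 4 ^ M * D ≤ β ^ M
  4^M*D≤β^M = *-cancelˡ-≤ (4 ^ M) {{m^n≢0 4 M}} (begin
    4 ^ M * (4 ^ M * D) ≡⟨ *-assoc (4 ^ M) (4 ^ M) D ⟨
    4 ^ M * 4 ^ M * D   ≡⟨ cong (_* D) (^-distribʳ-* 4 4 M) ⟨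
    16 ^ M * D          ≤⟨ 16^M*D≤c^M ⟩
    c ^ M               ≤⟨ ^-monoˡ-≤ M c≤4β ⟩
    (4 * β) ^ M         ≡⟨ ^-distribʳ-* 4 β M ⟩
    4 ^ M * β ^ M       ∎)

  d≤β : d ≤ β
  d≤β = ^-cancelʳ-≤ M (begin
    -- `D` is `d * d ^ M`, so `d ^ M` is far below `4 ^ M * D`.
    d ^ M     ≤⟨ m≤n*m (d ^ M) d ⟩
    D         ≤⟨ m≤n*m D (4 ^ M) {{m^n≢0 4 M}} ⟩
    4 ^ M * D ≤⟨ 4^M*D≤β^M ⟩
    β ^ M     ∎)

  2β+d≤c : 2 * β + d ≤ c
  2β+d≤c = begin
    2 * β + d ≤⟨ +-monoʳ-≤ (2 * β) d≤β ⟩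
    2 * β + β ≡⟨ trans (+-comm (2 * β) β) (*-comm 3 β) ⟩
    β * 3     ≤⟨ m/n*n≤m c 3 ⟩
    c         ∎

  few : 2 ^ M * (M * D) ≤ β ^ M
  few = begin
    2 ^ M * (M * D)     ≤⟨ *-monoʳ-≤ (2 ^ M) (*-monoˡ-≤ D (n≤2^n M)) ⟩
    2 ^ M * (2 ^ M * D) ≡⟨ *-assoc (2 ^ M) (2 ^ M) D ⟨
    2 ^ M * 2 ^ M * D   ≡⟨ cong (_* D) (^-distribʳ-* 2 2 M) ⟨
    4 ^ M * D           ≤⟨ 4^M*D≤β^M ⟩
    β ^ M               ∎

-- From the real bound to the chromatic number.

pathColourable-Δ : ∀ m c {n} (G : Graph n) → 1 ≤ m → 2 ≤ Δ G →
                   360 ^ suc m * (Δ G ^ (2 + m)) ^ 2 ≤ c ^ (2 * suc m) →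
                   PathColourable (3 + m) G c
pathColourable-Δ m c G 1≤m 2≤Δ large =
  pathColourable G m β {{>-nonZero (≤-trans z<s 16≤c)}} {{>-nonZero (≤-trans z<s 2≤β)}}
    1≤m 2β+d≤c few
  where open Numerics (suc m) c (Δ G) 2≤Δ large

-- By computation the product of radicals has index `2 * q` and radicand `360 ^ q * (d ^ p) ^ 2`,
-- with 360 = 6² · 10; only the exponent 1 contributed by `⟦ c ⟧` has to be removed.
≤ʳ-power : ∀ d p q .{{_ : NonZero q}} c → ⟦ 6 ⟧ · √ 10 · d ^[ p / q ] ≤ʳ ⟦ c ⟧ →
           360 ^ q * (d ^ p) ^ 2 ≤ c ^ (2 * q)
≤ʳ-power d p q c = subst (_≤ c ^ (2 * q)) (^-identityʳ _)

theorem5 : ∀ (k d n : ℕ) (4≤k : 4 ≤ k) → 2 ≤ d →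
    (G : Graph n) → Δ G ≡ d →
    let instance
          k-2≢0 : NonZero (k ∸ 2)
          k-2≢0 = ∸2-nonZero (<⇒≤ 4≤k)
    in s k (<⇒≤ 4≤k) G ≤ ⌈ ⟦ 6 ⟧ · √ 10 · d ^[ k ∸ 1 / k ∸ 2 ] ⌉
theorem5 _ _ n 4≤k@(s≤s (s≤s (s≤s (s≤s {n = m} _)))) 2≤d G refl =
  -- By minimality a colouring with `⌈ x ⌉` colours suffices. Here `k = 4 + m`, so the parameter
  -- `k - 3` is `suc m`.
  Least.minimal (leastColours (<⇒≤ 4≤k) G)
    (pathColourable-Δ (suc m) ⌈ x ⌉ G (s≤s z≤n) 2≤d
      (≤ʳ-power (Δ G) (3 + m) (2 + m) ⌈ x ⌉ (Least.holds (leastAbove x))))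
  where
  x : Radical
  x = ⟦ 6 ⟧ · √ 10 · Δ G ^[ 3 + m / 2 + m ]
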